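{- Let $(\vec f,\vec\theta,\rho,\vec{\mathcal J})$ be a Definitional SMTO problem over a background theory $T$. Assume that $T$-satisfiability of quantifier-free formulas with uninterpreted functions is decidable, and that the SMT solver called in Algorithm 1 is a decision procedure for it, always returning SAT with a model or UNSAT. Assume further that every oracle function symbol $\theta_i$ has a finite domain, i.e. there are only finitely many tuples of input values on which $\theta_i$ can be applied. Then Algorithm 1 terminates on this problem.
   Context: Notation: for an expression $e$ with a free variable $x$, $e\cdot\{x\to t\}$ denotes proper substitution of $x$ by $t$. The symbol $\approx$ denotes equality. An oracle interface is a tuple $\mathcal I=(\vec y,\vec z,\alpha_{gen},\beta_{gen})$, where $\vec y$ and $\vec z$ are lists of sorted variables and $\alpha_{gen},\beta_{gen}$ are formulas whose free variables are among $\vec y,\vec z$. Its associated oracle maps tuples of values of the sorts of $\vec y$ to tuples of values of the sorts of $\vec z$. An oracle interface $\mathcal J$ defines an oracle function symbol $\theta$ if it has the form $((y_1,\dots,y_j),(z),\ \theta(y_1,\dots,y_j)\approx z,\ \text{true})$ and its associated oracle is functional, i.e. it always returns the same output on the same input; calling it on $\vec c$ with result $d$ generates the assumption $\theta(\vec c)\approx d$. A Definitional SMTO problem is a tuple $(\vec f,\vec\theta,\rho,\vec{\mathcal J})$, where $\vec f$ are ordinary function symbols, $\vec\theta=(\theta_1,\dots,\theta_n)$ are oracle function symbols, $\rho$ is a formula in background theory $T$ whose free function symbols are $\vec f\uplus\vec\theta$, and $\vec{\mathcal J}=(\mathcal J_1,\dots,\mathcal J_n)$ with $\mathcal J_i$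 defining $\theta_i$. Notation for the algorithm: $e[t]$ denotes an expression with a subterm $t$, and $e[s]$ denotes the result of replacing that subterm by $s$. $\langle t\rangle$ denotes partial evaluation of $t$, i.e. evaluating every subterm built from interpreted symbols applied to values; for example $\langle\theta(1+1)+1\rangle=\theta(2)+1$. $M|_{\vec f}$ is the restriction of a model $M$ to $\vec f$, and $\vec f^M$ is the interpretation of $\vec f$ in $M$. Algorithm 1 (SMTO). Initialize $A:=\text{true}$. Then repeat the following forever: 1. Call the SMT solver on $\rho\wedge A$, treating $\vec\theta$ as uninterpreted functions. If the result is UNSAT, return (UNSAT, $A$). 2. Otherwise, let $M$ be the model returned and set $\mu:=\langle\rho\cdot\{\vec f\to\vec f^M\}\rangle$. 3. While $\mu$ has the form $\mu[\theta_i(\vec c)]$ with $\vec c$ a tuple of values: - if $\theta_i(\vec c)\approx d$ is already in $A$ for some $d$, set $\mu:=\langle\mu[d]\rangle$; - otherwise call the oracle of $\mathcal J_i$ on $\vec c$ to obtain $d$, add $\theta_i(\vec c)\approx d$ to $A$, and set $\mu:=\langle\mu[d]\rangle$. 4. If $\mu$ is the formula true, return (SAT, $A$, $M|_{\vec f}$). Otherwise continue with the next iteration of the loop. -}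

module Defs where

open import Data.Bool.Base using (Bool; true; false; not; _∧_; _∨_; if_then_else_)
open import Data.Bool.Properties using () renaming (_≟_ to _≟ᵇ_)
open import Data.List.Base using (List; []; _∷_; [_]; _++_; foldr)
open import Data.List.Membership.Propositional using (_∈_)
open import Data.List.Membership.Propositional.Properties using (∈-++⁺ˡ; ∈-++⁺ʳ; ∈-++⁻)
open import Data.List.Relation.Unary.All using (All; []; _∷_; lookup; tabulate)
open import Data.List.Relation.Unary.Any using (here)
open import Data.Maybe.Base using (Maybe; just; nothing; maybe)
open import Data.Product.Base using (Σ-syntax; ∃-syntax; _×_; _,_)
open import Data.Sum.Base using (_⊎_; inj₁; inj₂; [_,_]′)
open import Function.Base using (_∘_)
open import Relation.Binary.Definitions using (DecidableEquality)
open import Relation.Binary.PropositionalEquality using (_≡_; _≢_; refl)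
open import Relation.Nullary.Decidable.Core using (does)
open import Relation.Nullary.Negation.Core using (¬_)

data Sort (B : Set) : Set where
  bool : Sort B
  base : B → Sort B

Rank : Set → Set
Rank B = List (Sort B) × Sort B

Value : {B : Set} → (B → Set) → Sort B → Set
Value V bool     = Bool
Value V (base b) = V b

Fun : {B : Set} → (B → Set) → Rank B → Set
Fun V (ss , s) = All (Value V) ss → Value V s

-- A theory is a signature together with a class of structures, its models.  All
-- models interpret a sort by the same set, its values: a value is a constant of
-- the language, oracles exchange values independently of any model, and the
-- interpretation of a function symbol must send values to values.
record Theory : Set₁ where
  field
    BaseSort  : Set
    BaseValue : BaseSort → Set
    _≟ᵛ_      : ∀ {b} → DecidableEquality (BaseValue b)
    Op        : Rank BaseSort → Set
    IsModel   : (∀ {r} → Op r → Fun BaseValue r) → Set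

module _ (T : Theory) where
  open Theory T

  Srt Rnk : Set
  Srt = Sort BaseSort
  Rnk = Rank BaseSort

  Val : Srt → Set
  Val = Value BaseValue

  Tuple : List Srt → Set
  Tuple = All Val

  ⟪_⟫ : Rnk → Set
  ⟪_⟫ = Fun BaseValue

  equal? : ∀ s → DecidableEquality (Val s)
  equal? bool     = _≟ᵇ_
  equal? (base b) = _≟ᵛ_

  Structure : Set
  Structure = ∀ {r} → Op r → ⟪ r ⟫

  data Interpreted : Rnk → Set where
    neg             : Interpreted ([ bool ] , bool)
    and or implies  : Interpreted (bool ∷ bool ∷ [] , bool)
    equals          : ∀ s → Interpreted (s ∷ s ∷ [] , bool)
    ite             : ∀ s → Interpreted (bool ∷ s ∷ s ∷ [] , s)
    op              : ∀ {r} → Op r → Interpreted r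

  ⟦_⟧ᵒ : ∀ {r} → Interpreted r → Structure → ⟪ r ⟫
  ⟦ neg ⟧ᵒ      I (a ∷ [])         = not a
  ⟦ and ⟧ᵒ      I (a ∷ b ∷ [])     = a ∧ b
  ⟦ or ⟧ᵒ       I (a ∷ b ∷ [])     = a ∨ b
  ⟦ implies ⟧ᵒ  I (a ∷ b ∷ [])     = not a ∨ b
  ⟦ equals s ⟧ᵒ I (a ∷ b ∷ [])     = does (equal? s a b)
  ⟦ ite s ⟧ᵒ    I (a ∷ b ∷ c ∷ []) = if a then b else c
  ⟦ op o ⟧ᵒ     I                  = I o

  -- Quantifier-free terms with variables in Γ and free function symbols in K.
  data Term (K : Rnk → Set) (Γ : List Srt) : Srt → Set where
    var  : ∀ {s} → s ∈ Γ → Term K Γ s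
    val  : ∀ {s} → Val s → Term K Γ s
    app  : ∀ {ss s} → Interpreted (ss , s) → All (Term K Γ) ss → Term K Γ s
    free : ∀ {ss s} → K (ss , s) → All (Term K Γ) ss → Term K Γ s

  -- A list of ranks declares one uninterpreted function symbol per position, so
  -- that symbols of equal rank remain distinct.
  Symbols : Set
  Symbols = List Rnk

  Formula : Symbols → List Srt → Set
  Formula Δ Γ = Term (_∈ Δ) Γ bool

  infix 4 _≈_

  _≈_ : ∀ {K Γ s} → Term K Γ s → Term K Γ s → Term K Γ bool
  t ≈ u = app (equals _) (t ∷ u ∷ [])

  _∧ᶠ_ : ∀ {K Γ} → Term K Γ bool → Term K Γ bool → Term K Γ bool
  φ ∧ᶠ ψ = app and (φ ∷ ψ ∷ [])

  vals : ∀ {K Γ ss} → Tuple ss → All (Term K Γ) ss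
  vals []       = []
  vals (c ∷ cs) = val c ∷ vals cs

  record Model (Δ : Symbols) : Set where
    field
      structure : Structure
      isModel   : IsModel structure
      _^        : ∀ {r} → r ∈ Δ → ⟪ r ⟫

  module _ {Δ : Symbols} (M : Model Δ) where
    open Model M

    mutual
      ⟦_⟧ : ∀ {Γ s} → Term (_∈ Δ) Γ s → Tuple Γ → Val s
      ⟦ var x ⟧     η = lookup η x
      ⟦ val c ⟧     η = c
      ⟦ app o ts ⟧  η = ⟦ o ⟧ᵒ structure (⟦ ts ⟧* η)
      ⟦ free f ts ⟧ η = (f ^) (⟦ ts ⟧* η)

      ⟦_⟧* : ∀ {Γ ss} → All (Term (_∈ Δ) Γ) ss → Tuple Γ → Tuple ss
      ⟦ [] ⟧*     η = []
      ⟦ t ∷ ts ⟧* η = ⟦ t ⟧ η ∷ ⟦ ts ⟧* η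

  _⊨_ : ∀ {Δ} → Model Δ → Formula Δ [] → Set
  M ⊨ φ = ⟦_⟧ M φ [] ≡ true

  Satisfiable : ∀ {Δ} → Formula Δ [] → Set
  Satisfiable {Δ} φ = Σ[ M ∈ Model Δ ] M ⊨ φ

  data Answer (Δ : Symbols) : Set where
    unsat : Answer Δ
    sat   : Model Δ → Answer Δ

  Solver : Set
  Solver = ∀ {Δ} → Formula Δ [] → Answer Δ

  -- Solvers are total, so the existence of one that is a decision procedure is
  -- the decidability of satisfiability for quantifier-free formulas.
  IsDecisionProcedure : Solver → Set
  IsDecisionProcedure solve =
      (∀ {Δ} (φ : Formula Δ []) M → solve φ ≡ sat M → M ⊨ φ)
    × (∀ {Δ} (φ : Formula Δ []) → solve φ ≡ unsat → ¬ Satisfiable φ)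

  -- Returns c d: the oracle may answer d when called on c.
  record Oracle (ins outs : List Srt) : Set₁ where
    field
      Returns : Tuple ins → Tuple outs → Set
      answers : ∀ c → ∃[ d ] Returns c d

  Functional : ∀ {ins outs} → Oracle ins outs → Set
  Functional o = ∀ {c d d′} → Returns c d → Returns c d′ → d ≡ d′
    where open Oracle o

  record OracleInterface (Δ : Symbols) : Set₁ where
    constructor interface
    field
      ins outs  : List Srt
      αgen βgen : Formula Δ (ins ++ outs)
      oracle    : Oracle ins outs

  data Defines {Δ : Symbols} : OracleInterface Δ → ∀ {r} → r ∈ Δ → Set₁ where
    defines : ∀ {ss s} {θ : (ss , s) ∈ Δ} (o : Oracle ss [ s ]) → Functional o →
              Defines (interface ss [ s ]
                         (free θ (tabulate (var ∘ ∈-++⁺ˡ)) ≈ var (∈-++⁺ʳ ss (here refl)))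
                         (val true)
                         o)
                      θ

  DefiningReturns : ∀ {Δ J ss s} {θ : (ss , s) ∈ Δ} →
                    Defines J θ → Tuple ss → Val s → Set
  DefiningReturns (defines o _) c d = Oracle.Returns o c (d ∷ [])

  record DefinitionalSMTO : Set₁ where
    field
      F Θ  : Symbols
      ρ    : Formula (F ++ Θ) []
      J    : ∀ {r} → r ∈ Θ → OracleInterface (F ++ Θ)
      defs : ∀ {r} (θ : r ∈ Θ) → Defines (J θ) (∈-++⁺ʳ F θ)

  FiniteDomain : ∀ {Θ : Symbols} {r} → r ∈ Θ → Set
  FiniteDomain {r = ss , _} _ = Σ[ cs ∈ List (Tuple ss) ] (∀ c → c ∈ cs)

  -- Free symbols of ρ·{f → fᴹ}: functions on values, substituted for the ordinary
  -- symbols, and the oracle symbols.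
  Residual : Symbols → Rnk → Set
  Residual Θ r = ⟪ r ⟫ ⊎ r ∈ Θ

  Residuum : Symbols → Srt → Set
  Residuum Θ = Term (Residual Θ) []

  module _ (F : Symbols) {Θ : Symbols} (f^ : ∀ {r} → r ∈ F → ⟪ r ⟫) where

    substSymbol : ∀ {r} → r ∈ F ++ Θ → Residual Θ r
    substSymbol g = [ inj₁ ∘ f^ , inj₂ ]′ (∈-++⁻ F g)

    mutual
      substF : ∀ {s} → Term (_∈ F ++ Θ) [] s → Residuum Θ s
      substF (var ())
      substF (val c)     = val c
      substF (app o ts)  = app o (substF* ts)
      substF (free g ts) = free (substSymbol g) (substF* ts)

      substF* : ∀ {ss} → All (Term (_∈ F ++ Θ) []) ss → All (Residuum Θ) ss
      substF* []       = []
      substF* (t ∷ ts) = substF t ∷ substF* ts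

  values? : ∀ {K Γ ss} → All (Term K Γ) ss → Maybe (Tuple ss)
  values? []           = just []
  values? (val c ∷ ts) = maybe (just ∘ (c ∷_)) nothing (values? ts)
  values? (_     ∷ ts) = nothing

  module _ {Θ : Symbols} (I : Structure) where

    mutual
      ⟨_⟩ : ∀ {s} → Residuum Θ s → Residuum Θ s
      ⟨ var () ⟩
      ⟨ val c ⟩            = val c
      ⟨ app o ts ⟩         = maybe (val ∘ ⟦ o ⟧ᵒ I) (app o ⟨ ts ⟩*) (values? ⟨ ts ⟩*)
      ⟨ free (inj₁ f) ts ⟩ = maybe (val ∘ f) (free (inj₁ f) ⟨ ts ⟩*) (values? ⟨ ts ⟩*)
      ⟨ free (inj₂ θ) ts ⟩ = free (inj₂ θ) ⟨ ts ⟩*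

      ⟨_⟩* : ∀ {ss} → All (Residuum Θ) ss → All (Residuum Θ) ss
      ⟨ [] ⟩*     = []
      ⟨ t ∷ ts ⟩* = ⟨ t ⟩ ∷ ⟨ ts ⟩*

  -- Replace t u e e′: e is e[t], for one occurrence of t, and e′ is e[u].
  mutual
    data Replace {Θ σ} (t u : Residuum Θ σ) : ∀ {s} → Residuum Θ s → Residuum Θ s → Set where
      whole   : Replace t u t u
      in-app  : ∀ {ss s} {o : Interpreted (ss , s)} {ts ts′} →
                Replace* t u ts ts′ → Replace t u (app o ts) (app o ts′)
      in-free : ∀ {ss s} {k : Residual Θ (ss , s)} {ts ts′} →
                Replace* t u ts ts′ → Replace t u (free k ts) (free k ts′)

    data Replace* {Θ σ} (t u : Residuum Θ σ) :
                  ∀ {ss} → All (Residuum Θ) ss → All (Residuum Θ) ss → Set where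
      at-head : ∀ {s ss} {e e′ : Residuum Θ s} {es : All (Residuum Θ) ss} →
                Replace t u e e′ → Replace* t u (e ∷ es) (e′ ∷ es)
      at-tail : ∀ {s ss} {e : Residuum Θ s} {es es′ : All (Residuum Θ) ss} →
                Replace* t u es es′ → Replace* t u (e ∷ es) (e ∷ es′)

  -- fact θ c d is the assumption θ(c) ≈ d.
  data Fact (Θ : Symbols) : Set where
    fact : ∀ {ss s} → (ss , s) ∈ Θ → Tuple ss → Val s → Fact Θ

  module Algorithm (P : DefinitionalSMTO) (solve : Solver) where
    open DefinitionalSMTO P

    Assumptions : Set
    Assumptions = List (Fact Θ)

    assumption : Fact Θ → Formula (F ++ Θ) []
    assumption (fact θ c d) = free (∈-++⁺ʳ F θ) (vals c) ≈ val d

    conj : Assumptions → Formula (F ++ Θ) []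
    conj = foldr (λ a φ → assumption a ∧ᶠ φ) (val true)

    query : Assumptions → Formula (F ++ Θ) []
    query A = ρ ∧ᶠ conj A

    _|F : Model (F ++ Θ) → ∀ {r} → r ∈ F → ⟪ r ⟫
    (M |F) f = Model._^ M (∈-++⁺ˡ f)

    data Result : Set where
      UNSAT : Assumptions → Result
      SAT   : Assumptions → (∀ {r} → r ∈ F → ⟪ r ⟫) → Result

    data State : Set where
      outer    : Assumptions → State
      inner    : Assumptions → Model (F ++ Θ) → Residuum Θ bool → State
      returned : Result → State

    OracleCall : ∀ {ss s} → (ss , s) ∈ Θ → Tuple ss → Residuum Θ s
    OracleCall θ c = free (inj₂ θ) (vals c)

    NoCall : Residuum Θ bool → Set
    NoCall μ = ∀ {ss s} (θ : (ss , s) ∈ Θ) c {u μ′} →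
               ¬ Replace (OracleCall θ c) u μ μ′

    infix 4 _⟶_

    data _⟶_ : State → State → Set where
      solver-unsat : ∀ {A} → solve (query A) ≡ unsat → outer A ⟶ returned (UNSAT A)
      solver-sat   : ∀ {A M} → solve (query A) ≡ sat M →
                     outer A ⟶ inner A M (⟨_⟩ (Model.structure M) (substF F (M |F) ρ))
      reuse        : ∀ {A M μ μ′ ss s} {θ : (ss , s) ∈ Θ} {c d} →
                     fact θ c d ∈ A →
                     Replace (OracleCall θ c) (val d) μ μ′ →
                     inner A M μ ⟶ inner A M (⟨_⟩ (Model.structure M) μ′)
      call         : ∀ {A M μ μ′ ss s} {θ : (ss , s) ∈ Θ} {c d} →
                     (∀ d′ → ¬ fact θ c d′ ∈ A) →
                     DefiningReturns (defs θ) c d →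
                     Replace (OracleCall θ c) (val d) μ μ′ →
                     inner A M μ ⟶ inner (fact θ c d ∷ A) M (⟨_⟩ (Model.structure M) μ′)
      accept       : ∀ {A M μ} → NoCall μ → μ ≡ val true →
                     inner A M μ ⟶ returned (SAT A (M |F))
      continue     : ∀ {A M μ} → NoCall μ → μ ≢ val true →
                     inner A M μ ⟶ outer A

    -- Every run from the state is finite and ends by returning a result; runs
    -- branch over the choice of the call to replace and over oracle answers.
    data TerminatesFrom : State → Set where
      halted : ∀ {R} → TerminatesFrom (returned R)
      steps  : ∀ {S} → ∃[ S′ ] (S ⟶ S′) →
               (∀ {S′} → S ⟶ S′ → TerminatesFrom S′) → TerminatesFrom S

    Terminates : Set
    Terminates = TerminatesFrom (outer [])

{-# OPTIONS --safe #-}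

-- Each step of the inner loop removes an oracle symbol from μ, so the inner loop
-- is finite.  When it stops, μ is a value, because partial evaluation evaluates
-- every subterm that contains no call.  If the oracles have not been called since
-- the model M was found, then M satisfies all assumptions, hence every
-- replacement preserves the value of μ in M; this value is that of ρ, which is
-- true, so the algorithm accepts.  Thus an iteration that does not return asks at
-- least one call that has not been asked before, and there are finitely many.
module Submission where

open import Defs
open import Data.Bool.Base using (true; false; _∧_)
open import Data.List.Base using (List; []; _∷_; _++_; length; map)
open import Data.List.Membership.DecPropositional using (_∈?_)
open import Data.List.Membership.Propositional using (_∈_; _∉_)
open import Data.List.Membership.Propositional.Properties using (∈-++⁺ˡ; ∈-++⁺ʳ; ∈-++⁻; ∈-map⁺; ∈-map⁻)
open import Data.List.Properties using (length-removeAt′)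
open import Data.List.Relation.Unary.All using (All; []; _∷_)
open import Data.List.Relation.Unary.Any using (here; there; index; _─_)
open import Data.List.Relation.Unary.Any.Properties using (++⁺∘++⁻)
open import Data.Maybe.Base using (just; nothing)
open import Data.Nat.Base using (ℕ; zero; suc; _+_; _≤_; _<_; z≤n; s≤s)
open import Data.Nat.Induction using (<-wellFounded)
open import Data.Nat.Properties using (≤-<-trans; +-mono-≤; +-monoˡ-<; +-monoʳ-<; suc-injective)
open import Data.Product.Base using (Σ-syntax; ∃-syntax; _×_; _,_; proj₁; proj₂)
open import Data.Sum.Base using (_⊎_; inj₁; inj₂; map₁)
open import Function.Base using (_∘_)
open import Induction.WellFounded using (Acc; acc; WellFounded)
open import Relation.Binary.Definitions using (DecidableEquality)
open import Relation.Binary.PropositionalEquality using (_≡_; _≢_; refl; sym; trans; cong; cong₂)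
open import Relation.Nullary.Decidable.Core using (yes; no)
open import Relation.Nullary.Negation.Core using (contradiction)

-- Well-foundedness of adding new elements of a finite set.

module _ {X : Set} where

  ∈-─⁺ : ∀ {x y : X} {xs} (x∈xs : x ∈ xs) → y ≢ x → y ∈ xs → y ∈ (xs ─ x∈xs)
  ∈-─⁺ (here refl)  y≢x (here refl)  = contradiction refl y≢x
  ∈-─⁺ (here refl)  y≢x (there y∈xs) = y∈xs
  ∈-─⁺ (there x∈xs) y≢x (here refl)  = here refl
  ∈-─⁺ (there x∈xs) y≢x (there y∈xs) = there (∈-─⁺ x∈xs y≢x y∈xs)

  -- The longer list is the smaller one, so accessibility of `xs` bounds how often a new element can
  -- still be put in front of it.
  data _≺_ : List X → List X → Set where
    fresh : ∀ {x xs} → x ∉ xs → (x ∷ xs) ≺ xs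

  ≺-wellFounded : (universe : List X) → (∀ x → x ∈ universe) → WellFounded _≺_
  ≺-wellFounded universe complete xs = below (length universe) universe refl (λ {x} _ → complete x)
    where
    below : ∀ n unused → length unused ≡ n → ∀ {xs} → (∀ {x} → x ∉ xs → x ∈ unused) → Acc _≺_ xs
    below zero    []     _    covers = acc λ { (fresh x∉xs) → contradiction (covers x∉xs) λ () }
    below (suc n) unused size covers = acc λ { (fresh x∉xs) →
      below n (unused ─ covers x∉xs)
        (suc-injective (trans (sym (length-removeAt′ unused (index (covers x∉xs)))) size))
        λ y∉ → ∈-─⁺ (covers x∉xs) (y∉ ∘ here) (covers (y∉ ∘ there)) }

-- Oracle calls: finiteness and decidable equality.

module _ {T : Theory} where

  open Theory T

  -- Answers are left out, so that finite domains give finitely many calls even where an output sort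
  -- has infinitely many values.
  Call : Symbols T → Set
  Call Θ = Σ[ r ∈ Rnk T ] r ∈ Θ × Tuple T (proj₁ r)

  callOf : ∀ {Θ} → Fact T Θ → Call Θ
  callOf (fact {ss} {s} θ c _) = (ss , s) , θ , c

  asked : ∀ {Θ} → List (Fact T Θ) → List (Call Θ)
  asked = map callOf

  asked⁺ : ∀ {Θ A ss s} {θ : (ss , s) ∈ Θ} {c d} → fact θ c d ∈ A → ((ss , s) , θ , c) ∈ asked A
  asked⁺ = ∈-map⁺ callOf

  asked⁻ : ∀ {Θ A ss s} {θ : (ss , s) ∈ Θ} {c} → ((ss , s) , θ , c) ∈ asked A → ∃[ d ] fact θ c d ∈ A
  asked⁻ k∈A with ∈-map⁻ callOf k∈A
  ... | fact _ _ d , a∈A , refl = d , a∈A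

  later : ∀ {Θ r} → Call Θ → Call (r ∷ Θ)
  later (_ , θ , c) = _ , there θ , c

  calls : ∀ {Θ} → (∀ {r} (θ : r ∈ Θ) → FiniteDomain T θ) → Σ[ ks ∈ List (Call Θ) ] (∀ k → k ∈ ks)
  calls {[]}    finite = [] , λ { (_ , () , _) }
  calls {r ∷ Θ} finite = map first (proj₁ inputs) ++ map later (proj₁ rest) , complete
    where
    first : Tuple T (proj₁ r) → Call (r ∷ Θ)
    first c = r , here refl , c

    inputs = finite (here refl)
    rest   = calls {Θ} (finite ∘ there)

    complete : ∀ k → k ∈ (map first (proj₁ inputs) ++ map later (proj₁ rest))
    complete (_ , here refl , c) = ∈-++⁺ˡ (∈-map⁺ first (proj₂ inputs c))
    complete (_ , there θ , c)   = ∈-++⁺ʳ (map first (proj₁ inputs)) (∈-map⁺ later (proj₂ rest (_ , θ , c)))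

  ≟-tuple : ∀ {ss} → DecidableEquality (Tuple T ss)
  ≟-tuple []       []       = yes refl
  ≟-tuple {s ∷ _} (v ∷ vs) (w ∷ ws) with equal? T s v w | ≟-tuple vs ws
  ... | yes refl | yes refl = yes refl
  ... | no v≢w   | _        = no λ { refl → v≢w refl }
  ... | _        | no vs≢ws = no λ { refl → vs≢ws refl }

  -- Sorts need not have decidable equality, but positions in Θ do.
  ≟-call : ∀ {Θ} → DecidableEquality (Call Θ)
  ≟-call (_ , here refl , c) (_ , here refl , c′) with ≟-tuple c c′
  ... | yes refl = yes refl
  ... | no c≢c′  = no λ { refl → c≢c′ refl }
  ≟-call (_ , here _ , _)    (_ , there _ , _)    = no λ ()
  ≟-call (_ , there _ , _)   (_ , here _ , _)     = no λ ()
  ≟-call (_ , there θ , c)   (_ , there θ′ , c′) with ≟-call (_ , θ , c) (_ , θ′ , c′)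
  ... | yes refl = yes refl
  ... | no k≢k′  = no λ { refl → k≢k′ refl }

  answer : ∀ {Δ J ss s} {θ : (ss , s) ∈ Δ} (D : Defines T J θ) c → ∃[ d ] DefiningReturns T D c d
  answer (defines o _) c with Oracle.answers o c
  ... | d ∷ [] , returns = d , returns

  -- Partial evaluation yields a value or leaves a call.

  values?-vals : ∀ {K Γ ss} (c : Tuple T ss) → values? T (vals T {K} {Γ} c) ≡ just c
  values?-vals []      = refl
  values?-vals {K} {Γ} (_ ∷ c) rewrite values?-vals {K} {Γ} c = refl

  values?-just : ∀ {K Γ ss} (ts : All (Term T K Γ) ss) {c} → values? T ts ≡ just c → ts ≡ vals T c
  values?-just []           refl = refl
  values?-just (val v ∷ ts) eq with values? T ts in eq′
  values?-just (val v ∷ ts) refl | just _  = cong (val v ∷_) (values?-just ts eq′)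
  values?-just (val v ∷ ts) ()   | nothing
  values?-just (var _ ∷ _)    ()
  values?-just (app _ _ ∷ _)  ()
  values?-just (free _ _ ∷ _) ()

  module _ {Θ : Symbols T} where

    OracleCall : ∀ {ss s} → (ss , s) ∈ Θ → Tuple T ss → Residuum T Θ s
    OracleCall θ c = free (inj₂ θ) (vals T c)

    -- The occurrence is described by what can be put in its place: `val d` yields a step of the
    -- inner loop, and any `u` refutes `NoCall`.
    record HasCall {s} (e : Residuum T Θ s) : Set where
      constructor occurrence
      field
        {inputs}  : List (Srt T)
        {output}  : Srt T
        symbol    : (inputs , output) ∈ Θ
        arguments : Tuple T inputs
        replace   : ∀ u → ∃[ e′ ] Replace T (OracleCall symbol arguments) u e e′

    record HasCall* {ss} (es : All (Residuum T Θ) ss) : Set where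
      constructor occurrence
      field
        {inputs}  : List (Srt T)
        {output}  : Srt T
        symbol    : (inputs , output) ∈ Θ
        arguments : Tuple T inputs
        replace   : ∀ u → ∃[ es′ ] Replace* T (OracleCall symbol arguments) u es es′

    Settled : ∀ {s} → Residuum T Θ s → Set
    Settled e = HasCall e ⊎ ∃[ v ] e ≡ val v

    Settled* : ∀ {ss} → All (Residuum T Θ) ss → Set
    Settled* es = HasCall* es ⊎ ∃[ c ] es ≡ vals T c

    module _ (I : Structure T) where

      -- By induction on the term: a call in an argument is a call in the term. If all arguments are
      -- values, an interpreted symbol or a substituted function gets evaluated, while an oracle
      -- symbol is itself a call.
      ⟨⟩-settled : ∀ {s} (e : Residuum T Θ s) → Settled (⟨_⟩ T I e)
      ⟨⟩*-settled : ∀ {ss} (es : All (Residuum T Θ) ss) → Settled* (⟨_⟩* T I es)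

      ⟨⟩-settled (var ())
      ⟨⟩-settled (val v) = inj₂ (v , refl)
      ⟨⟩-settled (app o es) with ⟨⟩*-settled es
      ... | inj₂ (c , eq) rewrite eq | values?-vals {Residual T Θ} {[]} c = inj₂ (_ , refl)
      ... | inj₁ (occurrence θ c r) with values? T (⟨_⟩* T I es)
      -- Arguments containing a call are never all values, but the result here is a value anyway, so
      -- the case need not be refuted.
      ...   | just _  = inj₂ (_ , refl)
      ...   | nothing = inj₁ (occurrence θ c λ u → _ , in-app (proj₂ (r u)))
      ⟨⟩-settled (free (inj₁ f) es) with ⟨⟩*-settled es
      ... | inj₂ (c , eq) rewrite eq | values?-vals {Residual T Θ} {[]} c = inj₂ (_ , refl)
      ... | inj₁ (occurrence θ c r) with values? T (⟨_⟩* T I es)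
      ...   | just _  = inj₂ (_ , refl)
      ...   | nothing = inj₁ (occurrence θ c λ u → _ , in-free (proj₂ (r u)))
      ⟨⟩-settled (free (inj₂ θ) es) with ⟨⟩*-settled es
      ... | inj₂ (c , eq) rewrite eq = inj₁ (occurrence θ c λ u → u , whole)
      ... | inj₁ (occurrence θ′ c r) = inj₁ (occurrence θ′ c λ u → _ , in-free (proj₂ (r u)))

      ⟨⟩*-settled [] = inj₂ ([] , refl)
      ⟨⟩*-settled (e ∷ es) with ⟨⟩-settled e | ⟨⟩*-settled es
      ... | inj₁ (occurrence θ c r) | _ = inj₁ (occurrence θ c λ u → _ , at-head (proj₂ (r u)))
      ... | inj₂ _ | inj₁ (occurrence θ c r) = inj₁ (occurrence θ c λ u → _ , at-tail (proj₂ (r u)))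
      ... | inj₂ (v , eq) | inj₂ (c , eqs) = inj₂ (v ∷ c , cong₂ _∷_ eq eqs)

    -- Counting oracle symbols.

    size  : ∀ {s} → Residuum T Θ s → ℕ
    size* : ∀ {ss} → All (Residuum T Θ) ss → ℕ

    size (var _)            = 0
    size (val _)            = 0
    size (app _ es)         = size* es
    size (free (inj₁ _) es) = size* es
    size (free (inj₂ _) es) = suc (size* es)

    size* []       = 0
    size* (e ∷ es) = size e + size* es

    module _ (I : Structure T) where

      -- Symbols other than oracle symbols count nothing, and a term collapsed to a value has size
      -- 0.
      size-⟨⟩  : ∀ {s} (e : Residuum T Θ s) → size (⟨_⟩ T I e) ≤ size e
      size*-⟨⟩ : ∀ {ss} (es : All (Residuum T Θ) ss) → size* (⟨_⟩* T I es) ≤ size* es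

      size-⟨⟩ (var ())
      size-⟨⟩ (val _) = z≤n
      size-⟨⟩ (app _ es) with values? T (⟨_⟩* T I es)
      ... | just _  = z≤n
      ... | nothing = size*-⟨⟩ es
      size-⟨⟩ (free (inj₁ _) es) with values? T (⟨_⟩* T I es)
      ... | just _  = z≤n
      ... | nothing = size*-⟨⟩ es
      size-⟨⟩ (free (inj₂ _) es) = s≤s (size*-⟨⟩ es)

      size*-⟨⟩ []       = z≤n
      size*-⟨⟩ (e ∷ es) = +-mono-≤ (size-⟨⟩ e) (size*-⟨⟩ es)

    module _ {σ} {t u : Residuum T Θ σ} (u<t : size u < size t) where

      size-replace  : ∀ {s} {e e′ : Residuum T Θ s} → Replace T t u e e′ → size e′ < size e
      size*-replace : ∀ {ss} {es es′ : All (Residuum T Θ) ss} → Replace* T t u es es′ → size* es′ < size* es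

      size-replace whole                  = u<t
      size-replace (in-app r)             = size*-replace r
      size-replace (in-free {k = inj₁ _} r) = size*-replace r
      size-replace (in-free {k = inj₂ _} r) = s≤s (size*-replace r)

      size*-replace (at-head {es = es} r) = +-monoˡ-< (size* es) (size-replace r)
      size*-replace (at-tail {e = e} r)   = +-monoʳ-< (size e) (size*-replace r)

    size-step : ∀ (I : Structure T) {ss s} {θ : (ss , s) ∈ Θ} {c d σ} {e e′ : Residuum T Θ σ} →
                Replace T (OracleCall θ c) (val d) e e′ → size (⟨_⟩ T I e′) < size e
    -- `s≤s z≤n` compares the replacing value, of size 0, with the call, whose own symbol makes its
    -- size a successor.
    size-step I {e′ = e′} r = ≤-<-trans (size-⟨⟩ I e′) (size-replace (s≤s z≤n) r)

    -- Values of residual terms under an interpretation of the oracle symbols.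

    module _ (I : Structure T) (θ^ : ∀ {r} → r ∈ Θ → ⟪_⟫ T r) where

      eval  : ∀ {s} → Residuum T Θ s → Val T s
      eval* : ∀ {ss} → All (Residuum T Θ) ss → Tuple T ss

      eval (var ())
      eval (val v)            = v
      eval (app o es)         = ⟦_⟧ᵒ T o I (eval* es)
      eval (free (inj₁ f) es) = f (eval* es)
      eval (free (inj₂ θ) es) = θ^ θ (eval* es)

      eval* []       = []
      eval* (e ∷ es) = eval e ∷ eval* es

      eval*-vals : ∀ {ss} (c : Tuple T ss) → eval* (vals T c) ≡ c
      eval*-vals []      = refl
      eval*-vals (v ∷ c) = cong (v ∷_) (eval*-vals c)

      -- Partial evaluation uses the same `I` and leaves oracle symbols in place, so this holds for
      -- every `θ^`, whatever the oracles would answer.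
      eval-⟨⟩  : ∀ {s} (e : Residuum T Θ s) → eval (⟨_⟩ T I e) ≡ eval e
      eval*-⟨⟩ : ∀ {ss} (es : All (Residuum T Θ) ss) → eval* (⟨_⟩* T I es) ≡ eval* es
      values-⟨⟩ : ∀ {ss} (es : All (Residuum T Θ) ss) {c} → values? T (⟨_⟩* T I es) ≡ just c → c ≡ eval* es

      eval-⟨⟩ (var ())
      eval-⟨⟩ (val _) = refl
      eval-⟨⟩ (app o es) with values? T (⟨_⟩* T I es) in eq
      ... | just _  = cong (⟦_⟧ᵒ T o I) (values-⟨⟩ es eq)
      ... | nothing = cong (⟦_⟧ᵒ T o I) (eval*-⟨⟩ es)
      eval-⟨⟩ (free (inj₁ f) es) with values? T (⟨_⟩* T I es) in eq
      ... | just _  = cong f (values-⟨⟩ es eq)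
      ... | nothing = cong f (eval*-⟨⟩ es)
      eval-⟨⟩ (free (inj₂ θ) es) = cong (θ^ θ) (eval*-⟨⟩ es)

      eval*-⟨⟩ []       = refl
      eval*-⟨⟩ (e ∷ es) = cong₂ _∷_ (eval-⟨⟩ e) (eval*-⟨⟩ es)

      -- The evaluated arguments are literally `vals c`, so `c` is their value, which by the mutual
      -- induction is the value of `es`.
      values-⟨⟩ es {c} eq =
        trans (sym (eval*-vals c)) (trans (cong eval* (sym (values?-just _ eq))) (eval*-⟨⟩ es))

      module _ {σ} {t u : Residuum T Θ σ} (t≡u : eval t ≡ eval u) where

        eval-replace  : ∀ {s} {e e′ : Residuum T Θ s} → Replace T t u e e′ → eval e ≡ eval e′
        eval*-replace : ∀ {ss} {es es′ : All (Residuum T Θ) ss} → Replace* T t u es es′ → eval* es ≡ eval* es′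

        eval-replace whole                      = t≡u
        eval-replace (in-app {o = o} r)         = cong (⟦_⟧ᵒ T o I) (eval*-replace r)
        eval-replace (in-free {k = inj₁ f} r)   = cong f (eval*-replace r)
        eval-replace (in-free {k = inj₂ θ} r)   = cong (θ^ θ) (eval*-replace r)

        eval*-replace (at-head {es = es} r) = cong (_∷ eval* es) (eval-replace r)
        eval*-replace (at-tail {e = e} r)   = cong (eval e ∷_) (eval*-replace r)

  -- Substituting the functions of a model preserves values in it.

  module _ (F : Symbols T) {Θ : Symbols T} (M : Model T (F ++ Θ)) where

    open Model M

    evalM : ∀ {s} → Residuum T Θ s → Val T s
    evalM = eval structure (λ θ → (∈-++⁺ʳ F θ) ^)

    private
      f^ : ∀ {r} → r ∈ F → ⟪_⟫ T r
      f^ f = (∈-++⁺ˡ f) ^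

    eval-substF : ∀ {s} (t : Term T (_∈ F ++ Θ) [] s) → evalM (substF T F f^ t) ≡ ⟦_⟧ T M t []
    eval-substF* : ∀ {ss} (ts : All (Term T (_∈ F ++ Θ) []) ss) →
                   eval* structure (λ θ → (∈-++⁺ʳ F θ) ^) (substF* T F f^ ts) ≡ ⟦_⟧* T M ts []

    eval-substF (var ())
    eval-substF (val _)    = refl
    eval-substF (app o ts) = cong (⟦_⟧ᵒ T o structure) (eval-substF* ts)
    -- Matching `++⁺∘++⁻` with `refl` turns `g` into the injected position found by `∈-++⁻`, so both
    -- sides apply the same function of `M`.
    eval-substF (free g ts) with ∈-++⁻ F g | ++⁺∘++⁻ F g
    ... | inj₁ f | refl = cong (f^ f) (eval-substF* ts)
    ... | inj₂ θ | refl = cong ((∈-++⁺ʳ F θ) ^) (eval-substF* ts)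

    eval-substF* []       = refl
    eval-substF* (t ∷ ts) = cong₂ _∷_ (eval-substF t) (eval-substF* ts)

  ⟦vals⟧* : ∀ {Δ} (M : Model T Δ) {ss} (c : Tuple T ss) → ⟦_⟧* T M (vals T c) [] ≡ c
  ⟦vals⟧* M []      = refl
  ⟦vals⟧* M (v ∷ c) = cong (v ∷_) (⟦vals⟧* M c)

  ⊨-≈ : ∀ {Δ} (M : Model T Δ) {s} (t u : Term T (_∈ Δ) [] s) →
        _⊨_ T M (_≈_ T t u) → ⟦_⟧ T M t [] ≡ ⟦_⟧ T M u []
  ⊨-≈ M {s} t u holds with equal? T s (⟦_⟧ T M t []) (⟦_⟧ T M u []) | holds
  ... | yes t≡u | _  = t≡u
  ... | no _    | ()

∧-true : ∀ {a b} → a ∧ b ≡ true → a ≡ true × b ≡ true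
∧-true {true} b≡true = refl , b≡true

-- The invariant of the inner loop.

module _ {T : Theory} (P : DefinitionalSMTO T) (solve : Solver T)
         (correct : ∀ {Δ} (φ : Formula T Δ []) M → solve φ ≡ sat M → _⊨_ T M φ) where

  open DefinitionalSMTO P
  open Algorithm T P solve hiding (OracleCall)

  Satisfies : Model T (F ++ Θ) → Assumptions → Set
  Satisfies M A = ∀ {ss s} {θ : (ss , s) ∈ Θ} {c d} → fact θ c d ∈ A → Model._^ M (∈-++⁺ʳ F θ) c ≡ d

  ⊨-conj : ∀ M A → _⊨_ T M (conj A) → Satisfies M A
  ⊨-conj M (fact θ c d ∷ A) holds (here refl) =
    trans (cong (Model._^ M (∈-++⁺ʳ F θ)) (sym (⟦vals⟧* M c)))
          (⊨-≈ M (free (∈-++⁺ʳ F θ) (vals T c)) (val d) (proj₁ (∧-true holds)))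
  ⊨-conj M (a ∷ A) holds (there a∈A) = ⊨-conj M A (proj₂ (∧-true {⟦_⟧ T M (assumption a) []} holds)) a∈A

  -- This is maintained from the moment `M` is found until an oracle is called: a new answer may
  -- contradict `M`.
  Agrees : Assumptions → Model T (F ++ Θ) → Residuum T Θ bool → Set
  Agrees A M μ = Satisfies M A × evalM F M μ ≡ true

  agrees-initially : ∀ {A M} → solve (query A) ≡ sat M →
                     Agrees A M (⟨_⟩ T (Model.structure M) (substF T F (M |F) ρ))
  agrees-initially {A} {M} eq =
    ⊨-conj M A (proj₂ holds) ,
    trans (eval-⟨⟩ _ _ (substF T F (M |F) ρ)) (trans (eval-substF F M ρ) (proj₁ holds))
    where
    holds = ∧-true {⟦_⟧ T M ρ []} (correct (query A) M eq)

  agrees-reuse : ∀ {A M μ μ′ ss s} {θ : (ss , s) ∈ Θ} {c d} → fact θ c d ∈ A →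
                 Replace T (OracleCall θ c) (val d) μ μ′ →
                 Agrees A M μ → Agrees A M (⟨_⟩ T (Model.structure M) μ′)
  agrees-reuse {M = M} {μ′ = μ′} {θ = θ} {c} a∈A r (satisfies , true-in-M) =
    satisfies ,
    trans (eval-⟨⟩ _ _ μ′) (trans (sym (eval-replace structure _ call≡d r)) true-in-M)
    where
    open Model M
    call≡d = trans (cong ((∈-++⁺ʳ F θ) ^) (eval*-vals structure (λ θ → (∈-++⁺ʳ F θ) ^) c)) (satisfies a∈A)

  agrees-accepts : ∀ {A M μ} → Settled μ → NoCall μ → Agrees A M μ → μ ≡ val true
  agrees-accepts (inj₁ (occurrence θ c r)) noCall _ =
    -- `NoCall` forbids every replacement; the call itself serves as a replacing term of the right
    -- sort.
    contradiction (proj₂ (r (OracleCall θ c))) (noCall θ c)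
  agrees-accepts (inj₂ (v , refl)) _ (_ , refl) = refl

  -- Progress and termination of runs.

  outer-progress : ∀ A → ∃[ S ] outer A ⟶ S
  outer-progress A with solve (query A) in eq
  ... | unsat = _ , solver-unsat eq
  ... | sat M = _ , solver-sat eq

  inner-progress : ∀ A M {μ} → Settled μ → ∃[ S ] inner A M μ ⟶ S
  inner-progress A M (inj₁ (occurrence θ c r)) with _∈?_ (≟-call {T}) (_ , θ , c) (asked A)
  ... | yes k∈A with d , a∈A ← asked⁻ k∈A = _ , reuse a∈A (proj₂ (r (val d)))
  ... | no k∉A with d , returns ← answer (defs θ) c =
    _ , call (λ _ → k∉A ∘ asked⁺) returns (proj₂ (r (val d)))
  inner-progress A M (inj₂ (true  , refl)) = _ , accept (λ { _ _ () }) refl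
  inner-progress A M (inj₂ (false , refl)) = _ , continue (λ { _ _ () }) λ ()

  -- The recursion is lexicographic: `call` descends in `asked A`, while `reuse` keeps it and
  -- descends in the size of `μ`.
  outer-terminates : ∀ {A} → Acc _≺_ (asked A) → TerminatesFrom (outer A)
  outer-step       : ∀ {A S} → Acc _≺_ (asked A) → outer A ⟶ S → TerminatesFrom S
  -- `continue` descends in neither measure. The disjunction provides for it: before a new call the
  -- invariant excludes `continue`, and afterwards termination of the next iteration is already at
  -- hand.
  inner-terminates : ∀ {A M μ} → Acc _≺_ (asked A) → Acc _<_ (size μ) → Settled μ →
                     Agrees A M μ ⊎ TerminatesFrom (outer A) → TerminatesFrom (inner A M μ)
  inner-step       : ∀ {A M μ S} → Acc _≺_ (asked A) → Acc _<_ (size μ) → Settled μ →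
                     Agrees A M μ ⊎ TerminatesFrom (outer A) → inner A M μ ⟶ S → TerminatesFrom S

  outer-terminates {A} asking = steps (outer-progress A) (outer-step asking)

  outer-step _ (solver-unsat _) = halted
  outer-step {A} asking (solver-sat eq) =
    inner-terminates asking (<-wellFounded _) (⟨⟩-settled _ (substF T F _ ρ)) (inj₁ (agrees-initially {A} eq))

  inner-terminates {A} {M} asking shrinking settled outcome =
    steps (inner-progress A M settled) (inner-step asking shrinking settled outcome)

  inner-step {M = M} asking (acc smaller) settled outcome (reuse {μ′ = μ′} a∈A r) =
    inner-terminates asking (smaller (size-step _ r)) (⟨⟩-settled _ μ′)
      (map₁ (agrees-reuse {M = M} a∈A r) outcome)
  inner-step (acc more) (acc smaller) _ _ (call {μ′ = μ′} new _ r) =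
    -- Termination from the extended assumptions is obtained here, where accessibility has just
    -- descended, and is kept for a later `continue`.
    let asking = more (fresh λ k∈A → new _ (proj₂ (asked⁻ k∈A))) in
    inner-terminates asking (smaller (size-step _ r)) (⟨⟩-settled _ μ′) (inj₂ (outer-terminates asking))
  inner-step _ _ _ _ (accept _ _) = halted
  inner-step {M = M} _ _ settled (inj₁ agrees) (continue noCall μ≢true) =
    contradiction (agrees-accepts {M = M} settled noCall agrees) μ≢true
  inner-step _ _ _ (inj₂ ends) (continue _ _) = ends

mainTheorem3 : (T : Theory) (P : DefinitionalSMTO T) (solve : Solver T) →
    IsDecisionProcedure T solve →
    (∀ {r} (θ : r ∈ DefinitionalSMTO.Θ P) → FiniteDomain T θ) →
    Algorithm.Terminates T P solve
mainTheorem3 T P solve (correct , _) finite =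
  outer-terminates P solve correct (≺-wellFounded (proj₁ universe) (proj₂ universe) [])
  where
  universe = calls {T} finite
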